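{- Let $G$ be a connected graph of order $n$ and diameter $d$. If $2^{d-3}\geq n-d$, then $\tau(G)\leq d$.
   Context: Graphs are finite, simple and undirected; the order of a graph is its number of vertices; $d_G(x,y)$ is the distance between $x$ and $y$ in $G$; the diameter is the maximum distance between two vertices. A vertex $w$ resolves a pair of vertices $u,v$ if $d_G(u,w)\neq d_G(v,w)$. A set $W\subseteq V(G)$ is a resolving set for $G$ if every pair of distinct vertices of $G$ is resolved by some vertex of $W$. The metric dimension $\beta(G)$ is the minimum cardinality of a resolving set for $G$ (with $\beta(K_1)=0$). The threshold dimension is $\tau(G)=\min\{\beta(H): H \text{ contains } G \text{ as a spanning subgraph}\}$, i.e. the minimum metric dimension among all graphs $H$ with $V(H)=V(G)$ and $E(G)\subseteq E(H)$. -}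

module Defs where

open import Data.Fin.Base using (Fin)
open import Data.Fin.Subset using (Subset; _∈_; ∣_∣)
open import Data.Integer.Base using (ℤ; +_; -[1+_])
open import Data.Nat.Base using (ℕ; zero; suc; _≤_; _^_)
open import Data.Nat.Properties using (m^n≢0)
open import Data.Product.Base using (∃; ∃₂; _×_)
open import Data.Rational.Base using (ℚ; _/_)
open import Level using (Level; 0ℓ)
open import Relation.Binary.Core using (Rel)
open import Relation.Binary.Definitions using (Symmetric; Irreflexive; Decidable)
open import Relation.Binary.PropositionalEquality.Core using (_≡_; _≢_)

-- Least P m reads "m = min { k | P k }", and Greatest P m "m = max { k | P k }".
-- Each determines m uniquely and includes the claim that the extremum is attained.

Least : {ℓ : Level} → (ℕ → Set ℓ) → ℕ → Set ℓ
Least P m = P m × (∀ k → P k → m ≤ k)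

Greatest : {ℓ : Level} → (ℕ → Set ℓ) → ℕ → Set ℓ
Greatest P m = P m × (∀ k → P k → k ≤ m)

-- Adjacency is decidable, as it always is classically; this is what makes the
-- graph finite data.

record Graph (n : ℕ) : Set₁ where
  infix 4 _~_ _~?_
  field
    _~_      : Rel (Fin n) 0ℓ
    ~-sym    : Symmetric _~_
    ~-irrefl : Irreflexive _≡_ _~_
    _~?_     : Decidable _~_

infixr 5 _∷_

data Walk {n : ℕ} (G : Graph n) : Fin n → Fin n → ℕ → Set where
  []  : ∀ {u} → Walk G u u zero
  _∷_ : ∀ {u v w k} → Graph._~_ G u v → Walk G v w k → Walk G u w (suc k)

Connected : {n : ℕ} → Graph n → Set
Connected G = ∀ u v → ∃ λ k → Walk G u v k

IsDistance : {n : ℕ} → Graph n → Fin n → Fin n → ℕ → Set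
IsDistance G u v = Least (Walk G u v)

-- The graph with no vertices has no diameter.

IsDiameter : {n : ℕ} → Graph n → ℕ → Set
IsDiameter G = Greatest (λ k → ∃₂ λ u v → IsDistance G u v k)

-- Asking for both distances to exist costs nothing where this is used: only
-- connected graphs occur, since a graph with a connected spanning subgraph is
-- connected.

Resolves : {n : ℕ} → Graph n → Fin n → Fin n → Fin n → Set
Resolves G w u v = ∃₂ λ i j → IsDistance G u w i × IsDistance G v w j × i ≢ j

ResolvingSet : {n : ℕ} → Graph n → Subset n → Set
ResolvingSet G W = ∀ u v → u ≢ v → ∃ λ w → w ∈ W × Resolves G w u v

IsMetricDimension : {n : ℕ} → Graph n → ℕ → Set
IsMetricDimension G = Least (λ k → ∃ λ W → ResolvingSet G W × ∣ W ∣ ≡ k)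

-- The vertex sets agree by typing, so only the edges need comparing.

SpanningSubgraph : {n : ℕ} → Graph n → Graph n → Set
SpanningSubgraph G H = ∀ u v → Graph._~_ G u v → Graph._~_ H u v

IsThresholdDimension : {n : ℕ} → Graph n → ℕ → Set₁
IsThresholdDimension G =
  Least (λ k → ∃ λ H → SpanningSubgraph G H × IsMetricDimension H k)

-- Powers of two with an integer exponent: truncating a negative exponent to 0
-- would change the meaning of a bound such as 2^(d - 3) ≥ n - d for d < 3.

2^_ : ℤ → ℚ
2^ (+ k)      = + (2 ^ k) / 1
2^ (-[1+ k ]) = (+ 1 / (2 ^ suc k)) ⦃ m^n≢0 2 (suc k) ⦄

{-# OPTIONS --safe #-}

-- Let v be an end of a diametral path and choose w j at distance j + 1 from v, for j < d.
-- A vertex x at distance k from v can only be adjacent to the w j with |j + 1 - k| ≤ 1,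
-- that is, to at most three consecutive ones.  Joining x to such a window and to an
-- arbitrary set of others realises 2^(d - 3) neighbourhoods within {w j}, so the n - d
-- remaining vertices can be given pairwise distinct ones, and then {w j} resolves by
-- telling distance 1 from distance at least 2.

module Submission where

open import Defs
open import Data.Integer.Base using (+_; _-_)
open import Data.Nat.Base using (ℕ; _≤_)
open import Data.Product.Base using (∃; _×_)
open import Data.Rational.Base using (_/_) renaming (_≥_ to _≥ℚ_)
open import Data.Bool.Base using (Bool; true; false)
import Data.Bool.Properties as Bool
open import Data.Empty using (⊥-elim)
open import Data.Fin.Base as Fin using (Fin; toℕ; zero; suc; finToFun; funToFin)
open import Data.Fin.Properties
  using (_≟_; any?; all?; toℕ≤pred[n]; toℕ-injective; injective⇒≤; <⇒notInjective; 2↔Bool;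
         funToFin-finToFin; suc-injective)
open import Data.Fin.Subset using (Subset; inside; outside; _∈_; ∣_∣; ⁅_⁆; ⋃; _∪_)
open import Data.Fin.Subset.Properties
  using (_∈?_; anySubset?; x∈⁅x⁆; ∣⁅x⁆∣≡1; ∣⊥∣≡0; p⊆p∪q; q⊆p∪q)
import Data.Integer.Base as ℤ
import Data.Integer.Properties as ℤ
open import Data.List.Base as List using (List; []; _∷_; _++_; length)
open import Data.List.Properties using (length-++; length-tabulate; length-map)
import Data.List.Membership.DecPropositional as DecMembership
open import Data.List.Membership.Propositional using () renaming (_∈_ to _∈ₗ_; _∉_ to _∉ₗ_)
open import Data.List.Membership.Propositional.Properties
  using (∈-map⁺; ∈-tabulate⁻; ∈-allFin; ∈-filter⁺; ∈-filter⁻; ∈-lookup)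
open import Data.List.Relation.Unary.All as All using ()
open import Data.List.Relation.Unary.AllPairs using ([]; _∷_)
open import Data.List.Relation.Unary.Any as Any using (here; there)
open import Data.List.Relation.Unary.Any.Properties using (lookup-index)
open import Data.List.Relation.Unary.Unique.Propositional using (Unique)
open import Data.List.Relation.Unary.Unique.Propositional.Properties
  using (++⁺; tabulate⁺; filter⁺; allFin⁺)
open import Data.Nat.Base using (zero; suc; _+_; _*_; _∸_; _^_; _<_; z≤n; s≤s; s≤s⁻¹)
import Data.Nat.Properties as ℕ
open import Data.Nat.Properties
  using (≤-antisym; ≤-trans; ≤-refl; ≤-reflexive; +-suc; +-monoʳ-≤; +-cancelˡ-≤; m≤n⇒m≤1+n;
         *-mono-≤; *-identityʳ; <⇒≤; m<n⇒0<n∸m;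
         m+[n∸m]≡n; m≤n+m∸n; +-comm; m^n>0; ∸-monoˡ-≤; ≤⇒≯)
open import Data.Product.Base using (_,_; proj₁; proj₂; map₂)
open import Data.Rational.Base as ℚ using ()
import Data.Rational.Properties as ℚ
import Data.Rational.Unnormalised.Base as ℚᵘ
import Data.Rational.Unnormalised.Properties as ℚᵘ
open import Data.Sum.Base using (_⊎_; inj₁; inj₂)
open import Data.Vec.Base as Vec using (Vec; []; _∷_; lookup; tabulate)
open import Data.Vec.Properties
  using (≡-dec; ∷-injectiveʳ; lookup∘tabulate; []=⇒lookup; lookup⇒[]=)
open import Function.Base using (_∘_)
open import Function.Bundles using (Injection; Inverse)
open import Function.Definitions using (Injective)
open import Function.Properties.Inverse using (↔⇒↣)
open import Level using (0ℓ)
open import Relation.Binary.Core using (Rel)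
open import Relation.Binary.Definitions using (Decidable; DecidableEquality)
open import Relation.Binary.PropositionalEquality
  using (_≡_; _≢_; refl; sym; trans; cong; cong₂; subst; subst₂)
open import Relation.Nullary using (¬_; Dec; yes; no; does; contradiction)
open import Relation.Nullary.Decidable
  using (map′; _×-dec_; _⊎-dec_; _→-dec_; ¬?; dec-true; decidable-stable)
import Relation.Unary as U

-- Finite search

least : {P : ℕ → Set} → U.Decidable P → ∀ {m} → P m → ∃ (Least P)
least P? {m} pm with P? 0
... | yes p0 = 0 , p0 , λ _ _ → z≤n
least P? {zero}  pm | no ¬p0 = contradiction pm ¬p0
least {P} P? {suc m} pm | no ¬p0 with least (P? ∘ suc) {m} pm
... | k , pk , min = suc k , pk , λ { zero p → contradiction p ¬p0 ; (suc j) p → s≤s (min j p) }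

-- The threshold dimension is a minimum over all supergraphs; this search makes that minimum
-- computable once a graph is encoded by `n` rows of subsets.
anyMatrix? : ∀ {n} m {P : Vec (Subset n) m → Set} → U.Decidable P → Dec (∃ P)
anyMatrix? zero    P? = map′ ([] ,_) (λ { ([] , p) → p }) (P? [])
anyMatrix? (suc m) P? = map′ (λ { (r , rs , p) → r ∷ rs , p }) (λ { (r ∷ rs , p) → r , rs , p })
  (anySubset? (λ r → anyMatrix? m (P? ∘ (r ∷_))))

module _ {B : Set} (_≟ᴮ_ : DecidableEquality B) where
  open DecMembership _≟ᴮ_ using () renaming (_∈?_ to _∈ₗ?_)

  -- Pigeonhole: if every `g k` occurred in `ys`, its index there would inject `Fin N` into the
  -- smaller `Fin (length ys)`.
  injective⇒∃∉ : ∀ {N} {g : Fin N → B} → Injective _≡_ _≡_ g →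
                 ∀ ys → length ys < N → ∃ λ k → g k ∉ₗ ys
  injective⇒∃∉ {g = g} g-inj ys len< with any? (λ k → ¬? (g k ∈ₗ? ys))
  ... | yes fresh = fresh
  ... | no ¬fresh = ⊥-elim (<⇒notInjective {f = Any.index ∘ covered} len< position-injective)
    where
    covered : ∀ k → g k ∈ₗ ys
    covered k = decidable-stable (g k ∈ₗ? ys) (λ k∉ → ¬fresh (k , k∉))

    position-injective : Injective _≡_ _≡_ (Any.index ∘ covered)
    position-injective {i} {j} eq = g-inj (trans (lookup-index (covered i))
      (trans (cong (List.lookup ys) eq) (sym (lookup-index (covered j)))))

  -- Choices are made one entry at a time: the entries already treated use up fewer than `N` values,
  -- while `g x` offers `N` distinct ones. A repeated entry does no harm, as its latest choice
  -- overrides the earlier one; `k₀` is the default off the list.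
  greedy : ∀ {A : Set} → DecidableEquality A → ∀ {N} → Fin N →
           (g : A → Fin N → B) → (∀ x → Injective _≡_ _≡_ (g x)) →
           (xs : List A) → length xs ≤ N →
           ∃ λ (c : A → Fin N) →
             ∀ {x y} → x ∈ₗ xs → y ∈ₗ xs → g x (c x) ≡ g y (c y) → x ≡ y
  greedy _≟ᴬ_ k₀ g g-inj []       _    = (λ _ → k₀) , λ ()
  greedy {A} _≟ᴬ_ {N} k₀ g g-inj (x ∷ xs) len≤ = c′ , λ {y} {z} → c′-injective y z
    where
    rest = greedy _≟ᴬ_ k₀ g g-inj xs (≤-trans (m≤n⇒m≤1+n ≤-refl) len≤)
    c = proj₁ rest
    used = List.map (λ y → g y (c y)) xs
    fresh = injective⇒∃∉ (g-inj x) used (≤-trans (s≤s (≤-reflexive (length-map _ xs))) len≤)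

    c′ : A → Fin N
    c′ y with y ≟ᴬ x
    ... | yes _ = proj₁ fresh
    ... | no  _ = c y

    tail : ∀ {y} → y ≢ x → y ∈ₗ x ∷ xs → y ∈ₗ xs
    tail y≢x (here y≡x) = contradiction y≡x y≢x
    tail _   (there y∈) = y∈

    unused : ∀ {y} → y ∈ₗ xs → g x (proj₁ fresh) ≢ g y (c y)
    unused y∈ eq = proj₂ fresh (subst (_∈ₗ used) (sym eq) (∈-map⁺ _ y∈))

    c′-injective : ∀ y z → y ∈ₗ x ∷ xs → z ∈ₗ x ∷ xs → g y (c′ y) ≡ g z (c′ z) → y ≡ z
    c′-injective y z y∈ z∈ eq with y ≟ᴬ x | z ≟ᴬ x
    ... | yes refl | yes refl = refl
    ... | yes refl | no z≢x   = contradiction eq (unused (tail z≢x z∈))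
    ... | no y≢x   | yes refl = contradiction (sym eq) (unused (tail y≢x y∈))
    ... | no y≢x   | no z≢x   = proj₂ rest (tail y≢x y∈) (tail z≢x z∈) eq

-- Counting the values and non-values of a finite map

lookup-injective : ∀ {A : Set} {xs : List A} → Unique xs → Injective _≡_ _≡_ (List.lookup xs)
lookup-injective (_ ∷ _)  {zero}  {zero}  _  = refl
lookup-injective (x∉ ∷ _) {zero}  {suc j} eq = contradiction eq (All.lookup x∉ (∈-lookup j))
lookup-injective (x∉ ∷ _) {suc i} {zero}  eq = contradiction (sym eq) (All.lookup x∉ (∈-lookup i))
lookup-injective (_ ∷ uq) {suc i} {suc j} eq = cong suc (lookup-injective uq eq)

module _ {n d} (w : Fin d → Fin n) where
  private module ListDec = DecMembership (_≟_ {n})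

  nonValues : List (Fin n)
  nonValues = List.filter (λ x → ¬? (x ListDec.∈? List.tabulate w)) (List.allFin n)

  ∈-nonValues : ∀ {x} → (∀ j → x ≢ w j) → x ∈ₗ nonValues
  ∈-nonValues {x} x∉ = ∈-filter⁺ _ (∈-allFin x)
    (λ x∈ → let j , eq = ∈-tabulate⁻ x∈ in x∉ j eq)

  -- The values of `w` followed by the non-values form a list without repetition, so looking up its
  -- positions is an injection into `Fin n`.
  length-nonValues : Injective _≡_ _≡_ w → d + length nonValues ≤ n
  length-nonValues w-inj = subst (_≤ n)
    (trans (length-++ (List.tabulate w)) (cong (_+ length nonValues) (length-tabulate w)))
    (injective⇒≤ (lookup-injective unique))
    where
    unique : Unique (List.tabulate w ++ nonValues)
    unique = ++⁺ (tabulate⁺ w-inj) (filter⁺ _ (allFin⁺ n))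
      (λ (x∈ , x∈′) → proj₂ (∈-filter⁻ _ {xs = List.allFin n} x∈′) x∈)

∣p∪q∣≤∣p∣+∣q∣ : ∀ {n} (p q : Subset n) → ∣ p ∪ q ∣ ≤ ∣ p ∣ + ∣ q ∣
∣p∪q∣≤∣p∣+∣q∣ []            []            = z≤n
∣p∪q∣≤∣p∣+∣q∣ (inside  ∷ p) (inside  ∷ q) =
  s≤s (≤-trans (∣p∪q∣≤∣p∣+∣q∣ p q) (+-monoʳ-≤ ∣ p ∣ (m≤n⇒m≤1+n ≤-refl)))
∣p∪q∣≤∣p∣+∣q∣ (inside  ∷ p) (outside ∷ q) = s≤s (∣p∪q∣≤∣p∣+∣q∣ p q)
∣p∪q∣≤∣p∣+∣q∣ (outside ∷ p) (inside  ∷ q) =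
  ≤-trans (s≤s (∣p∪q∣≤∣p∣+∣q∣ p q)) (≤-reflexive (sym (+-suc ∣ p ∣ ∣ q ∣)))
∣p∪q∣≤∣p∣+∣q∣ (outside ∷ p) (outside ∷ q) = ∣p∪q∣≤∣p∣+∣q∣ p q

image : ∀ {n d} → (Fin d → Fin n) → Subset n
image w = ⋃ (List.tabulate (⁅_⁆ ∘ w))

∈-image : ∀ {n d} (w : Fin d → Fin n) j → w j ∈ image w
∈-image w zero    = p⊆p∪q (image (w ∘ suc)) (x∈⁅x⁆ (w zero))
∈-image w (suc j) = q⊆p∪q ⁅ w zero ⁆ _ (∈-image (w ∘ suc) j)

∣image∣≤ : ∀ {n d} (w : Fin d → Fin n) → ∣ image w ∣ ≤ d
∣image∣≤ {n} {zero}  w = ≤-reflexive (∣⊥∣≡0 n)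
∣image∣≤ {n} {suc d} w = ≤-trans (∣p∪q∣≤∣p∣+∣q∣ ⁅ w zero ⁆ _)
  (subst (λ k → k + ∣ image (w ∘ suc) ∣ ≤ suc d) (sym (∣⁅x⁆∣≡1 (w zero))) (s≤s (∣image∣≤ (w ∘ suc))))

-- Walks and distances

module _ {n} (G : Graph n) where
  open Graph G

  walk? : ∀ k u v → Dec (Walk G u v k)
  walk? zero    u v = map′ (λ { refl → [] }) (λ { [] → refl }) (u ≟ v)
  walk? (suc k) u v = map′ (λ { (_ , e , p) → e ∷ p }) (λ { (e ∷ p) → _ , e , p })
    (any? (λ w → u ~? w ×-dec walk? k w v))

  infixr 5 _⊹_
  _⊹_ : ∀ {u v w i j} → Walk G u v i → Walk G v w j → Walk G u w (i + j)
  []      ⊹ q = q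
  (e ∷ p) ⊹ q = e ∷ (p ⊹ q)

  splitWalk : ∀ i {j u v} → Walk G u v (i + j) → ∃ λ x → Walk G u x i × Walk G x v j
  splitWalk zero    p       = _ , [] , p
  splitWalk (suc i) (e ∷ p) = let x , q , r = splitWalk i p in x , e ∷ q , r

  distance-unique : ∀ {u v i j} → IsDistance G u v i → IsDistance G u v j → i ≡ j
  distance-unique (p , p-min) (q , q-min) = ≤-antisym (p-min _ q) (q-min _ p)

  module _ (conn : Connected G) where

    distance : ∀ u v → ∃ (IsDistance G u v)
    distance u v = least (λ k → walk? k u v) (proj₂ (conn u v))

    dist : Fin n → Fin n → ℕ
    dist u v = proj₁ (distance u v)

    dist-walk : ∀ u v → Walk G u v (dist u v)
    dist-walk u v = proj₁ (proj₂ (distance u v))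

    dist-min : ∀ {u v k} → Walk G u v k → dist u v ≤ k
    dist-min p = proj₂ (proj₂ (distance _ _)) _ p

    dist≢⇒resolves : ∀ {w u v} → dist u w ≢ dist v w → Resolves G w u v
    dist≢⇒resolves {w} {u} {v} ≢ =
      _ , _ , proj₂ (distance u w) , proj₂ (distance v w) , ≢

    resolves? : ∀ w u v → Dec (Resolves G w u v)
    resolves? w u v = map′ dist≢⇒resolves
      (λ (i , j , i-dist , j-dist , i≢j) eq → i≢j
        (trans (distance-unique i-dist (proj₂ (distance u w)))
          (trans eq (distance-unique (proj₂ (distance v w)) j-dist))))
      (¬? (dist u w ℕ.≟ dist v w))

    resolvingSet? : U.Decidable (ResolvingSet G)
    resolvingSet? W = all? λ u → all? λ v →
      ¬? (u ≟ v) →-dec any? (λ w → w ∈? W ×-dec resolves? w u v)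

    dist-~ : ∀ {x y} v → x ~ y → dist x v ≤ suc (dist y v)
    dist-~ v e = dist-min (e ∷ dist-walk _ v)

    -- Cut a shortest walk from `u` to `v` at `k` steps before its end. A shorter way from the cut
    -- vertex to `v` would, after the first `d ∸ k` steps, give a walk from `u` to `v` of length
    -- below `d`.
    all-levels : ∀ {u v d} → IsDistance G u v d → ∀ {k} → k ≤ d → ∃ λ x → dist x v ≡ k
    all-levels {u} {v} {d} (p , p-min) {k} k≤d =
      let i = d ∸ k
          i+k≡d = trans (+-comm i k) (m+[n∸m]≡n k≤d)
          x , q , r = splitWalk i (subst (Walk G u v) (sym i+k≡d) p)
      in x , ≤-antisym (dist-min r)
               (+-cancelˡ-≤ i _ _ (subst (_≤ i + dist x v) (sym i+k≡d)
                 (p-min _ (q ⊹ dist-walk x v))))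

-- Spanning supergraphs

walk-mono : ∀ {n} {G H : Graph n} → SpanningSubgraph G H →
            ∀ {u v k} → Walk G u v k → Walk H u v k
walk-mono G⊆H []      = []
walk-mono G⊆H (e ∷ p) = G⊆H _ _ e ∷ walk-mono G⊆H p

connected-mono : ∀ {n} {G H : Graph n} → SpanningSubgraph G H → Connected G → Connected H
connected-mono G⊆H conn u v = map₂ (walk-mono G⊆H) (conn u v)

-- Graphs with equivalent adjacency have the same walks, hence the same distances. This compares a
-- graph with its matrix encoding, where the adjacency relations are only equivalent.
resolvingSet-resp : ∀ {n} {G H : Graph n} → SpanningSubgraph G H → SpanningSubgraph H G →
                    ∀ {W} → ResolvingSet G W → ResolvingSet H W
resolvingSet-resp {G = G} {H} G⊆H H⊆G res u v u≢v =
  let w , w∈W , i , j , i-dist , j-dist , i≢j = res u v u≢v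
  in w , w∈W , i , j , transport i-dist , transport j-dist , i≢j
  where
  transport : ∀ {x y k} → IsDistance G x y k → IsDistance H x y k
  transport (p , p-min) = walk-mono G⊆H p , λ k q → p-min k (walk-mono H⊆G q)

module _ {n} (G : Graph n) where
  open Graph G

  addEdges : {R : Rel (Fin n) 0ℓ} → Decidable R → Graph n
  addEdges {R} R? = record
    { _~_      = λ x y → x ≢ y × (x ~ y ⊎ R x y ⊎ R y x)
    ; ~-sym    = λ { (x≢y , inj₁ e)        → x≢y ∘ sym , inj₁ (~-sym e)
                   ; (x≢y , inj₂ (inj₁ r)) → x≢y ∘ sym , inj₂ (inj₂ r)
                   ; (x≢y , inj₂ (inj₂ r)) → x≢y ∘ sym , inj₂ (inj₁ r) }
    ; ~-irrefl = λ { refl (x≢x , _) → x≢x refl }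
    ; _~?_     = λ x y → ¬? (x ≟ y) ×-dec (x ~? y ⊎-dec R? x y ⊎-dec R? y x)
    }

  ⊆-addEdges : ∀ {R : Rel (Fin n) 0ℓ} (R? : Decidable R) → SpanningSubgraph G (addEdges R?)
  ⊆-addEdges R? u v e = (λ u≡v → ~-irrefl u≡v e) , inj₁ e

  -- A graph carries an arbitrary relation and cannot be enumerated; matrices can, and up to
  -- equivalent adjacency every spanning supergraph of `G` arises from one.
  withMatrix : Vec (Subset n) n → Graph n
  withMatrix M = addEdges (λ x y → y ∈? lookup M x)

  ⊆-withMatrix : ∀ M → SpanningSubgraph G (withMatrix M)
  ⊆-withMatrix M = ⊆-addEdges (λ x y → y ∈? lookup M x)

module _ {n} (H : Graph n) where
  open Graph H

  adjacencyMatrix : Vec (Subset n) n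
  adjacencyMatrix = tabulate (λ x → tabulate (λ y → does (x ~? y)))

  lookup-adjacencyMatrix : ∀ x y → lookup (lookup adjacencyMatrix x) y ≡ does (x ~? y)
  lookup-adjacencyMatrix x y = trans (cong (λ r → lookup r y) (lookup∘tabulate _ x)) (lookup∘tabulate _ y)

  ~⇒∈ : ∀ {x y} → x ~ y → y ∈ lookup adjacencyMatrix x
  ~⇒∈ {x} {y} e = lookup⇒[]= y _ (trans (lookup-adjacencyMatrix x y) (dec-true (x ~? y) e))

  ∈⇒~ : ∀ {x y} → y ∈ lookup adjacencyMatrix x → x ~ y
  ∈⇒~ {x} {y} y∈ with x ~? y | trans (sym (lookup-adjacencyMatrix x y)) ([]=⇒lookup y∈)
  ... | yes e | _ = e
  ... | no _  | ()

  module _ (G : Graph n) where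

    ⊆-withAdjacencyMatrix : SpanningSubgraph H (withMatrix G adjacencyMatrix)
    ⊆-withAdjacencyMatrix x y e = (λ x≡y → ~-irrefl x≡y e) , inj₂ (inj₁ (~⇒∈ e))

    withAdjacencyMatrix-⊆ : SpanningSubgraph G H → SpanningSubgraph (withMatrix G adjacencyMatrix) H
    withAdjacencyMatrix-⊆ G⊆H x y (_ , inj₁ e)         = G⊆H x y e
    withAdjacencyMatrix-⊆ G⊆H x y (_ , inj₂ (inj₁ y∈)) = ∈⇒~ y∈
    withAdjacencyMatrix-⊆ G⊆H x y (_ , inj₂ (inj₂ x∈)) = ~-sym (∈⇒~ x∈)

-- Minimising the size of a resolving set over all supergraphs at once gives the same number as
-- minimising their metric dimensions. The pair `H`, `W` shows that the search ends and bounds its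
-- result.
thresholdDimension≤ : ∀ {n} {G H : Graph n} {W} → Connected G → SpanningSubgraph G H →
                      ResolvingSet H W → ∃ λ t → IsThresholdDimension G t × t ≤ ∣ W ∣
thresholdDimension≤ {n} {G} {H} {W} conn G⊆H res =
  let t , (M , attained) , t-min = least resolvable? (encode H G⊆H (W , res , refl))
  in t
   -- The metric dimension of the graph found is exactly `t`: a smaller resolving set for it would
   -- undercut the minimum over all matrices.
   , ( (withMatrix G M , ⊆-withMatrix G M , attained , λ k r → t-min k (M , r))
     , λ k (H′ , G⊆H′ , r , _) → t-min k (encode H′ G⊆H′ r))
   , t-min _ (encode H G⊆H (W , res , refl))
  where
  HasResolvingSet : Graph n → ℕ → Set
  HasResolvingSet H k = ∃ λ W → ResolvingSet H W × ∣ W ∣ ≡ k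

  Resolvable : ℕ → Set
  Resolvable k = ∃ λ M → HasResolvingSet (withMatrix G M) k

  resolvable? : U.Decidable Resolvable
  resolvable? k = anyMatrix? n λ M → anySubset? λ W →
    resolvingSet? (withMatrix G M) (connected-mono (⊆-withMatrix G M) conn) W
      ×-dec (∣ W ∣ ℕ.≟ k)

  encode : ∀ H {k} → SpanningSubgraph G H → HasResolvingSet H k → Resolvable k
  encode H G⊆H (W , res , eq) = adjacencyMatrix H , W ,
    resolvingSet-resp {G = H} {H = withMatrix G (adjacencyMatrix H)}
      (⊆-withAdjacencyMatrix H G) (withAdjacencyMatrix-⊆ H G G⊆H) res , eq

-- Codes

bits : ∀ {m} → Fin (2 ^ m) → Vec Bool m
bits k = tabulate (Inverse.to 2↔Bool ∘ finToFun k)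

bits-injective : ∀ {m} → Injective _≡_ _≡_ (bits {m})
bits-injective {m} {i} {j} eq = trans (sym (funToFin-finToFin {m} i))
  (trans (funToFin-cong pointwise) (funToFin-finToFin {m} j))
  where
  -- Recursion on the digits stands in for function extensionality.
  funToFin-cong : ∀ {k} {f g : Fin k → Fin 2} → (∀ x → f x ≡ g x) → funToFin f ≡ funToFin g
  funToFin-cong {zero}  f≗g = refl
  funToFin-cong {suc k} f≗g = cong₂ Fin.combine (f≗g zero) (funToFin-cong (f≗g ∘ suc))

  pointwise : ∀ x → finToFun i x ≡ finToFun j x
  pointwise x = Injection.injective (↔⇒↣ 2↔Bool) (trans (sym (lookup∘tabulate _ x))
    (trans (cong (λ v → lookup v x) eq) (lookup∘tabulate _ x)))

-- When the window would overrun the end of the vector, it is the last three positions.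
insertWindow : ∀ {m} → ℕ → Vec Bool m → Vec Bool (3 + m)
insertWindow zero    bs       = true ∷ true ∷ true ∷ bs
insertWindow (suc s) []       = true ∷ true ∷ true ∷ []
insertWindow (suc s) (b ∷ bs) = b ∷ insertWindow s bs

-- The place of the window depends only on `s` and the length, so removing it recovers the bits.
insertWindow-injective : ∀ {m} s → Injective _≡_ _≡_ (insertWindow {m} s)
insertWindow-injective zero    {bs}     {cs}     refl = refl
insertWindow-injective (suc s) {[]}     {[]}     _    = refl
insertWindow-injective (suc s) {b ∷ bs} {c ∷ cs} eq   =
  cong₂ _∷_ (cong Vec.head eq) (insertWindow-injective s (∷-injectiveʳ eq))

lookup-insertWindow : ∀ {m} s (bs : Vec Bool m) i → s ≤ toℕ i → toℕ i ≤ 2 + s →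
                      lookup (insertWindow s bs) i ≡ true
lookup-insertWindow zero    bs zero                _ _ = refl
lookup-insertWindow zero    bs (suc zero)          _ _ = refl
lookup-insertWindow zero    bs (suc (suc zero))    _ _ = refl
lookup-insertWindow zero    bs (suc (suc (suc _))) _ (s≤s (s≤s ()))
lookup-insertWindow (suc s) []       zero             _ _ = refl
lookup-insertWindow (suc s) []       (suc zero)       _ _ = refl
lookup-insertWindow (suc s) []       (suc (suc zero)) _ _ = refl
lookup-insertWindow (suc s) (b ∷ bs) (suc i) (s≤s s≤i) (s≤s i≤) = lookup-insertWindow s bs i s≤i i≤

-- The characteristic vector of a neighbourhood: `s` places the three forced positions and `k`
-- decides the other `m` freely.
code : ∀ {m} → ℕ → Fin (2 ^ m) → Vec Bool (3 + m)
code s k = insertWindow s (bits k)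

code-injective : ∀ {m} s → Injective _≡_ _≡_ (code {m} s)
code-injective s eq = bits-injective (insertWindow-injective s eq)

differ : ∀ {n} {u v : Vec Bool n} → u ≢ v → ∃ λ j → lookup u j ≢ lookup v j
differ {u = []}    {[]}    u≢v = contradiction refl u≢v
differ {u = a ∷ u} {b ∷ v} u≢v with a Bool.≟ b
... | no a≢b   = zero , a≢b
... | yes refl = let j , ≢ = differ (u≢v ∘ cong (a ∷_)) in suc j , ≢

-- Resolving by adjacency

module _ {n d} {G : Graph n} (conn : Connected G) {w : Fin d → Fin n} (w-inj : Injective _≡_ _≡_ w)
         (c : Fin n → Vec Bool d)
         (c-adj : ∀ {x j} → Graph._~_ G x (w j) → lookup (c x) j ≡ true)
         (c-inj : ∀ {x y} → (∀ j → x ≢ w j) → (∀ j → y ≢ w j) → c x ≡ c y → x ≡ y) where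
  open Graph G using (_~_)

  -- `c x` marks the intended neighbours of `x` among the `w j`; by `c-adj` the neighbours that `x`
  -- already has there are marked.
  Coded : Rel (Fin n) 0ℓ
  Coded x y = ∃ λ j → y ≡ w j × lookup (c x) j ≡ true

  coded? : Decidable Coded
  coded? x y = any? (λ j → y ≟ w j ×-dec lookup (c x) j Bool.≟ true)

  private
    H = addEdges G coded?

    G⊆H : SpanningSubgraph G H
    G⊆H = ⊆-addEdges G coded?

    conn-H : Connected H
    conn-H = connected-mono G⊆H conn

    -- No unintended neighbour appears: an old edge is covered by `c-adj`, an edge added for `x` is
    -- marked in its code, and an edge added for `w j` ends at some `w i`, which `x` is not.
    adjacent-code : ∀ {x j} → (∀ i → x ≢ w i) → Graph._~_ H x (w j) → lookup (c x) j ≡ true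
    adjacent-code x∉ (_ , inj₁ e)                   = c-adj e
    adjacent-code x∉ (_ , inj₂ (inj₁ (_ , eq , p))) = subst (λ j → lookup (c _) j ≡ true) (sym (w-inj eq)) p
    adjacent-code x∉ (_ , inj₂ (inj₂ (i , eq , _))) = contradiction eq (x∉ i)

    close-code : ∀ {x j k} → (∀ i → x ≢ w i) → Walk H x (w j) k → k ≤ 1 → lookup (c x) j ≡ true
    close-code x∉ []          _ = contradiction refl (x∉ _)
    close-code x∉ (e ∷ [])    _ = adjacent-code x∉ e
    close-code x∉ (_ ∷ _ ∷ _) (s≤s ())

    -- The marked bit puts `x` within distance 1 of `w j`. If `y` were equally far, it too would be
    -- within distance 1 and its bit would be marked.
    code-separates : ∀ {x y j} → (∀ i → x ≢ w i) → (∀ i → y ≢ w i) →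
                     lookup (c x) j ≡ true → lookup (c y) j ≢ true →
                     dist H conn-H x (w j) ≢ dist H conn-H y (w j)
    code-separates {x} {y} {j} x∉ y∉ x-adj ¬y-adj eq = ¬y-adj
      (close-code y∉ (dist-walk H conn-H y (w j))
        (subst (_≤ 1) eq (dist-min H conn-H ((x∉ j , inj₂ (inj₁ (j , refl , x-adj))) ∷ []))))

    source-resolves : ∀ j {v} → w j ≢ v → dist H conn-H (w j) (w j) ≢ dist H conn-H v (w j)
    source-resolves j {v} wj≢v eq
      with dist H conn-H v (w j) | dist-walk H conn-H v (w j)
         | subst (_≤ 0) eq (dist-min H conn-H {w j} [])
    ... | zero | [] | _ = wj≢v refl

  -- A pair containing some `w j` is resolved by `w j` itself, the only vertex at distance 0 from
  -- it. Any other pair has distinct codes and is resolved by the `w j` at a differing bit.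
  codes-resolve : ResolvingSet H (image w)
  codes-resolve u v u≢v with any? (λ j → u ≟ w j) | any? (λ j → v ≟ w j)
  ... | yes (j , refl) | _ = w j , ∈-image w j ,
    dist≢⇒resolves H conn-H (source-resolves j u≢v)
  ... | no _ | yes (j , refl) = w j , ∈-image w j ,
    dist≢⇒resolves H conn-H (source-resolves j (u≢v ∘ sym) ∘ sym)
  ... | no u∉ | no v∉ with differ (u≢v ∘ c-inj (λ j eq → u∉ (j , eq)) (λ j eq → v∉ (j , eq)))
  ... | j , ≢ with lookup (c u) j in cu | lookup (c v) j in cv
  ... | true  | true  = contradiction refl ≢
  ... | false | false = contradiction refl ≢
  ... | true  | false = w j , ∈-image w j , dist≢⇒resolves H conn-H
    (code-separates (λ j eq → u∉ (j , eq)) (λ j eq → v∉ (j , eq)) cu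
      (λ cv′ → contradiction (trans (sym cv) cv′) λ ()))
  ... | false | true  = w j , ∈-image w j , dist≢⇒resolves H conn-H
    (code-separates (λ j eq → v∉ (j , eq)) (λ j eq → u∉ (j , eq)) cv
      (λ cu′ → contradiction (trans (sym cu) cu′) λ ()) ∘ sym)

  thresholdDimension≤-coded : ∃ λ t → IsThresholdDimension G t × t ≤ d
  thresholdDimension≤-coded =
    let t , isτ , t≤ = thresholdDimension≤ conn G⊆H codes-resolve
    in t , isτ , ≤-trans t≤ (∣image∣≤ w)

-- Levels along a shortest path

module _ {n} {G : Graph n} (conn : Connected G) {u v d} (uv-dist : IsDistance G u v d) where

  levelVertex : Fin (suc d) → Fin n
  levelVertex i = proj₁ (all-levels G conn uv-dist (toℕ≤pred[n] i))

  dist-levelVertex : ∀ i → dist G conn (levelVertex i) v ≡ toℕ i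
  dist-levelVertex i = proj₂ (all-levels G conn uv-dist (toℕ≤pred[n] i))

  levelVertex-injective : Injective _≡_ _≡_ levelVertex
  levelVertex-injective {i} {j} eq = toℕ-injective (trans (sym (dist-levelVertex i))
    (trans (cong (λ x → dist G conn x v) eq) (dist-levelVertex j)))

  -- The levels 0 to `d` supply `d + 1` distinct vertices.
  distance<order : d < n
  distance<order = injective⇒≤ levelVertex-injective

-- At most `2 ^ m` vertices lie off the `w j`, and each has `2 ^ m` admissible codes, so the greedy
-- choice gives them distinct ones.
thresholdDimension≤distance : ∀ {n m} {G : Graph n} → Connected G →
  ∀ {u v} → IsDistance G u v (3 + m) → n ≤ 3 + m + 2 ^ m →
  ∃ λ t → IsThresholdDimension G t × t ≤ 3 + m
thresholdDimension≤distance {n} {m} {G} conn {u} {v} uv-dist n≤ =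
  thresholdDimension≤-coded conn w-inj c c-adj
    (λ x∉ y∉ → proj₂ coding (∈-nonValues w x∉) (∈-nonValues w y∉))
  where
  open Graph G using (_~_; ~-sym)

  w : Fin (3 + m) → Fin n
  -- The shift by `suc` leaves out level 0, that is `v`, so exactly `3 + m` levels are used.
  w j = levelVertex conn uv-dist (suc j)

  w-inj : Injective _≡_ _≡_ w
  w-inj = suc-injective ∘ levelVertex-injective conn uv-dist

  δ : Fin n → ℕ
  δ x = dist G conn x v

  -- Neighbours of `x` lie on levels `δ x - 1` to `δ x + 1`, and `w j` on level `j + 1`, so the
  -- indices to force run from `δ x - 2` to `δ x`.
  coding = greedy (≡-dec Bool._≟_) _≟_ (Fin.fromℕ< (m^n>0 2 m))
    (λ x → code (δ x ∸ 2)) (λ x → code-injective (δ x ∸ 2)) (nonValues w)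
    (+-cancelˡ-≤ (3 + m) _ _ (≤-trans (length-nonValues w w-inj) n≤))

  c : Fin n → Vec Bool (3 + m)
  c x = code (δ x ∸ 2) (proj₁ coding x)

  c-adj : ∀ {x j} → x ~ w j → lookup (c x) j ≡ true
  c-adj {x} {j} e = lookup-insertWindow (δ x ∸ 2) _ j
    (∸-monoˡ-≤ 2 (subst (λ k → δ x ≤ suc k) δw (dist-~ G conn v e)))
    -- This gives `j ≤ δ x`, and `δ x ≤ 2 + (δ x ∸ 2)` holds even when the subtraction truncates.
    (≤-trans (s≤s⁻¹ (subst (_≤ suc (δ x)) δw (dist-~ G conn v (~-sym e)))) (m≤n+m∸n (δ x) 2))
    where
    δw : δ (w j) ≡ suc (toℕ j)
    δw = dist-levelVertex conn uv-dist (suc j)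

-- Arithmetic of the hypothesis

-- Rational `_/_` reduces to lowest terms, hiding the given denominators; among unnormalised
-- rationals the order is cross multiplication itself.
/-≤⇒*-≤ : ∀ a b p q → a / suc p ℚ.≤ b / suc q → a ℤ.* + suc q ℤ.≤ b ℤ.* + suc p
/-≤⇒*-≤ a b p q a/p≤b/q = ℚᵘ.drop-*≤*
  (ℚᵘ.≤-respˡ-≃ (ℚ.toℚᵘ-fromℚᵘ (ℚᵘ.mkℚᵘ a p))
    (ℚᵘ.≤-respʳ-≃ (ℚ.toℚᵘ-fromℚᵘ (ℚᵘ.mkℚᵘ b q)) (ℚ.toℚᵘ-mono-≤ a/p≤b/q)))

excess≤ : ∀ {d n} b q → d < n → (+ n - + d) / 1 ℚ.≤ + b / suc q → (n ∸ d) * suc q ≤ b * 1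
excess≤ {d} {n} b q d<n hyp = ℤ.drop‿+≤+
  (subst₂ ℤ._≤_ (sym (ℤ.pos-* (n ∸ d) (suc q))) (sym (ℤ.pos-* b 1))
    (/-≤⇒*-≤ (+ (n ∸ d)) (+ b) 0 q (subst (λ z → z / 1 ℚ.≤ + b / suc q) n-d hyp)))
  where
  n-d : + n - + d ≡ + (n ∸ d)
  n-d = trans (ℤ.m-n≡m⊖n n d) (ℤ.⊖-≥ (<⇒≤ d<n))

-- The left side is an integer at least 1, the right side at most one half.
no-excess : ∀ {d n} q → d < n → ¬ ((+ n - + d) / 1 ℚ.≤ + 1 / suc (suc q))
no-excess q d<n hyp = ≤⇒≯ (excess≤ 1 (suc q) d<n hyp)
  (*-mono-≤ (m<n⇒0<n∸m d<n) (s≤s (s≤s (z≤n {q}))))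

corollary3p2 : (n d : ℕ) (G : Graph n) → Connected G → IsDiameter G d →
    (2^ (+ d - + 3)) ≥ℚ ((+ n - + d) / 1) →
    ∃ λ t → IsThresholdDimension G t × t ≤ d
corollary3p2 n d G conn ((u , v , uv-dist) , _) hyp with distance<order conn uv-dist
-- For `d` equal to 0, 1, 2 the power is 1/8, 1/4, 1/2, and the argument of `no-excess` is the
-- denominator minus 2.
corollary3p2 n 0 G conn _ hyp | d<n = contradiction hyp (no-excess 6 d<n)
corollary3p2 n 1 G conn _ hyp | d<n = contradiction hyp (no-excess 2 d<n)
corollary3p2 n 2 G conn _ hyp | d<n = contradiction hyp (no-excess 0 d<n)
corollary3p2 n (suc (suc (suc m))) G conn ((u , v , uv-dist) , _) hyp | d<n =
  thresholdDimension≤distance conn uv-dist (≤-trans (m≤n+m∸n n (3 + m))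
    (+-monoʳ-≤ (3 + m) (subst₂ _≤_ (*-identityʳ _) (*-identityʳ _) (excess≤ (2 ^ m) 0 d<n hyp))))
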